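{- Let $r\ge 2$ and $n\ge 1$ be integers with $r^2\mid n$, and assume that a Steiner system $S(2,r,r^2)$ exists. Then $$ex_r^{\mathrm{lin}}(n,P_4^r)\ge \frac{(r+1)n}{r}.$$
   Context: All hypergraphs are finite. A hypergraph is $r$-uniform if each hyperedge has exactly $r$ vertices, and linear if any two distinct hyperedges intersect in at most one vertex. A hypergraph $H$ contains $F$ as a subhypergraph if there is an injective map $V(F)\to V(H)$ sending every hyperedge of $F$ to a hyperedge of $H$; otherwise $H$ is $F$-free. The linear Turán number $ex_r^{\mathrm{lin}}(n,F)$ is the maximum number of hyperedges in an $F$-free linear $r$-uniform hypergraph on $n$ vertices. The expansion $G^r$ of a graph $G$ is the $r$-uniform hypergraph obtained by enlarging each edge of $G$ with $r-2$ new vertices, the new vertices for different edges being distinct. $P_4$ is the path with four edges (five vertices) and $P_4^r$ is its expansion; explicitly, four hyperedges $e_1,e_2,e_3,e_4$ of size $r$ such that consecutive ones meet in exactly one vertex, these three intersection vertices are distinct, and non-consecutive ones are disjoint. A Steiner system $S(2,r,m)$ is a set of $m$ vertices together with a family of $r$-element subsets (blocks, viewed as hyperedges) such that every pair of distinct vertices lies in exactly one block. -}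

module Defs where

open import Data.Bool.Base using (true; false; if_then_else_)
import Data.Bool.Properties as Bool
open import Data.Fin.Base using (Fin; zero; suc; inject₁; funToFin; finToFun)
open import Data.Fin.Properties using (_≟_; all?; any?; injective⇒≤; 2↔Bool; finToFun-funToFin)
open import Data.Fin.Subset using (Subset; _∈_; _∩_; _∪_; ⁅_⁆; ⊤; ⊥; ∣_∣)
open import Data.Fin.Subset.Properties using (_∈?_; anySubset?)
open import Data.Nat.Base using (ℕ; zero; suc; _+_; _*_; _∸_; _^_; _≤_; z≤n; s≤s)
import Data.Nat.Properties as ℕ
open import Data.Product using (∃; ∃!; ∃-syntax; Σ; Σ-syntax; _×_; _,_; proj₁; proj₂)
open import Data.Sum.Base using (inj₁; inj₂)
open import Data.Vec.Base using (_++_; concat; lookup; tabulate)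
open import Data.Vec.Functional using (_∷_)
import Data.Vec.Properties as Vec
open import Function.Base using (_∘_)
open import Function.Bundles using (Inverse)
open import Function.Definitions using (Injective)
open import Relation.Binary.PropositionalEquality
  using (_≡_; _≢_; _≗_; refl; sym; trans; cong; subst; subst₂; module ≡-Reasoning)
open import Relation.Nullary using (¬_; Dec; yes; no; does; contradiction)
open import Relation.Nullary.Decidable using (map′; from-yes; ¬?; _×-dec_; _→-dec_)
open import Relation.Unary using (Decidable)

private
  variable
    k l m n r : ℕ

-- A hypergraph on the vertex set Fin n with exactly m hyperedges; injectivity
-- of `edge` says that the hyperedges form a set rather than a multiset.
record Hypergraph (n m : ℕ) : Set where
  field
    edge           : Fin m → Subset n
    edge-injective : Injective _≡_ _≡_ edge

open Hypergraph public

Uniform : ℕ → Hypergraph n m → Set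
Uniform r H = ∀ i → ∣ edge H i ∣ ≡ r

Linear : Hypergraph n m → Set
Linear H = ∀ {i j} → i ≢ j → ∣ edge H i ∩ edge H j ∣ ≤ 1

image : (Fin k → Fin n) → Subset k → Subset n
image f e = tabulate λ y → does (any? λ x → (x ∈? e) ×-dec (f x ≟ y))

Contains : Hypergraph n m → Hypergraph k l → Set
Contains {n} {m} {k} {l} H F =
  Σ[ f ∈ (Fin k → Fin n) ]
    Injective _≡_ _≡_ f × (∀ i → ∃[ j ] image f (edge F i) ≡ edge H j)

Free : Hypergraph k l → Hypergraph n m → Set
Free F H = ¬ Contains H F

Graph : ℕ → ℕ → Set
Graph n m = Σ[ G ∈ Hypergraph n m ] Uniform 2 G

P₄ : Graph 5 4
P₄ = record
  { edge           = e
  ; edge-injective = λ {i} {j} → from-yes (all? λ i → all? λ j →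
      Vec.≡-dec Bool._≟_ (e i) (e j) →-dec (i ≟ j)) i j
  } , from-yes (all? λ i → ∣ e i ∣ ℕ.≟ 2)
  where
  e : Fin 4 → Subset 5
  e i = ⁅ inject₁ i ⁆ ∪ ⁅ suc i ⁆

-- The new vertices come after the k old ones, in m consecutive blocks of r ∸ 2;
-- the i-th edge is enlarged by the whole i-th block.  Meaningful for r ≥ 2.
expansion : (r : ℕ) → Graph k m → Hypergraph (k + m * (r ∸ 2)) m
expansion {k} {m} r (G , _) = record
  { edge           = λ i → edge G i ++ concat (tabulate (block i))
  ; edge-injective = λ {i} {j} eq →
      edge-injective G (Vec.++-injectiveˡ (edge G i) (edge G j) eq)
  }
  where
  block : Fin m → Fin m → Subset (r ∸ 2)
  block i j = if does (i ≟ j) then ⊤ else ⊥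

-- An S(2,r,v), with its blocks as the hyperedges of a hypergraph.
SteinerSystem : (r v : ℕ) → Set
SteinerSystem r v =
  ∃[ m ] Σ[ B ∈ Hypergraph v m ]
    Uniform r B × (∀ {x y} → x ≢ y → ∃! _≡_ λ i → x ∈ edge B i × y ∈ edge B i)

-- The hypergraphs over which the linear Turán number is a maximum.
Admissible : ℕ → Hypergraph k l → Hypergraph n m → Set
Admissible r F H = Uniform r H × Linear H × Free F H

-- The rest makes the maximum computable: whether an admissible hypergraph with
-- m edges exists is decidable, and m is at most 2 ^ n.

Searchable : Set → Set₁
Searchable A = {P : A → Set} → Decidable P → Dec (∃ P)

searchFun : {A : Set} → Searchable A → ∀ m {P : (Fin m → A) → Set} →
            (∀ {f g} → f ≗ g → P f → P g) → Decidable P → Dec (∃ P)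
searchFun search zero resp P? =
  map′ (λ p → _ , p) (λ (f , p) → resp (λ ()) p) (P? (λ ()))
searchFun search (suc m) {P} resp P? =
  map′ (λ (a , f , p) → (a ∷ f) , p)
       (λ (f , p) → f zero , (f ∘ suc) , resp (λ { zero → refl ; (suc _) → refl }) p)
       (search λ a → searchFun search m
         (λ f≗g → resp (λ { zero → refl ; (suc i) → f≗g i }))
         (λ f → P? (a ∷ f)))

injective? : {A : Set} → (∀ (x y : A) → Dec (x ≡ y)) →
             Decidable {A = Fin m → A} (Injective _≡_ _≡_)
injective? _≟A_ f =
  map′ (λ inj {i} {j} → inj i j) (λ inj i j → inj)
       (all? λ i → all? λ j → (f i ≟A f j) →-dec (i ≟ j))

injective-resp : {A : Set} {f g : Fin m → A} → f ≗ g →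
                 Injective _≡_ _≡_ f → Injective _≡_ _≡_ g
injective-resp f≗g inj eq = inj (trans (f≗g _) (trans eq (sym (f≗g _))))

_≟ₛ_ : (p q : Subset n) → Dec (p ≡ q)
_≟ₛ_ = Vec.≡-dec Bool._≟_

image-cong : {f g : Fin k → Fin n} → f ≗ g → ∀ e → image f e ≡ image g e
image-cong {f = f} {g} f≗g e = Vec.tabulate-cong same
  where
  hit? : (h : Fin _ → Fin _) → ∀ y → Dec (∃ λ x → x ∈ e × h x ≡ y)
  hit? h y = any? λ x → (x ∈? e) ×-dec (h x ≟ y)

  same : ∀ y → does (hit? f y) ≡ does (hit? g y)
  same y with hit? f y | hit? g y
  ... | yes _           | yes _           = refl
  ... | no  _           | no  _           = refl
  ... | yes (x , p , q) | no ¬b           = contradiction (x , p , trans (sym (f≗g x)) q) ¬b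
  ... | no ¬a           | yes (x , p , q) = contradiction (x , p , trans (f≗g x) q) ¬a

contains? : (H : Hypergraph n m) (F : Hypergraph k l) → Dec (Contains H F)
contains? {k = k} H F = searchFun any? k
  (λ f≗g (inj , hit) → (λ {x} {y} → injective-resp f≗g inj {x} {y}) ,
    λ i → let j , eq = hit i in j , trans (sym (image-cong f≗g (edge F i))) eq)
  (λ f → injective? _≟_ f ×-dec all? λ i → any? λ j → image f (edge F i) ≟ₛ edge H j)

admissible? : ∀ r (F : Hypergraph k l) (H : Hypergraph n m) → Dec (Admissible r F H)
admissible? r F H =
  all? (λ i → ∣ edge H i ∣ ℕ.≟ r)
  ×-dec map′ (λ lin {i} {j} → lin i j) (λ lin i j → lin)
    (all? λ i → all? λ j → ¬? (i ≟ j) →-dec (∣ edge H i ∩ edge H j ∣ ℕ.≤? 1))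
  ×-dec ¬? (contains? H F)

admissible-resp : (F : Hypergraph k l) {H K : Hypergraph n m} → edge H ≗ edge K →
                  Admissible r F H → Admissible r F K
admissible-resp F {H} {K} eq (uni , lin , free) =
  (λ i → subst (λ e → ∣ e ∣ ≡ _) (eq i) (uni i)) ,
  (λ {i} {j} i≢j → subst₂ (λ d e → ∣ d ∩ e ∣ ≤ 1) (eq i) (eq j) (lin i≢j)) ,
  λ (f , inj , hit) → free (f , inj ,
    λ i → let j , p = hit i in j , trans p (sym (eq j)))

Attainable : (r n : ℕ) → Hypergraph k l → ℕ → Set
Attainable r n F m = Σ[ H ∈ Hypergraph n m ] Admissible r F H

attainable? : ∀ r n (F : Hypergraph k l) → Decidable (Attainable r n F)
attainable? r n F m = map′
  (λ (e , inj , adm) → record { edge-injective = inj } , adm)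
  (λ (H , adm) → edge H , (λ {i} {j} → edge-injective H {i} {j}) , adm)
  (searchFun anySubset? m {P = P} resp P?)
  where
  family : (e : Fin m → Subset n) → Injective _≡_ _≡_ e → Hypergraph n m
  family e inj = record { edge = e ; edge-injective = inj }

  P : (Fin m → Subset n) → Set
  P e = Σ[ inj ∈ Injective _≡_ _≡_ e ] Admissible r F (family e inj)

  resp : ∀ {e e′} → e ≗ e′ → P e → P e′
  resp {e} {e′} eq (inj , adm) =
    (λ {i} {j} → inj′ {i} {j}) , admissible-resp F {family e inj} {family e′ inj′} eq adm
    where
    inj′ : Injective _≡_ _≡_ e′
    inj′ = injective-resp eq inj

  P? : Decidable P
  P? e with injective? _≟ₛ_ e
  ... | no ¬inj = no λ (inj , _) → ¬inj (λ {i} {j} → inj {i} {j})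
  ... | yes inj = map′ (λ adm → (λ {i} {j} → inj {i} {j}) , adm)
                       (λ (inj′ , adm) → admissible-resp F {family e inj′} {family e inj}
                                           (λ _ → refl) adm)
                       (admissible? r F (family e inj))

subsetIndex : Subset n → Fin (2 ^ n)
subsetIndex p = funToFin (Inverse.from 2↔Bool ∘ lookup p)

subsetIndex-injective : Injective _≡_ _≡_ (subsetIndex {n})
subsetIndex-injective {n} {p} {q} eq = begin
  p                    ≡⟨ Vec.tabulate∘lookup p ⟨
  tabulate (lookup p)  ≡⟨ Vec.tabulate-cong lookup-≗ ⟩
  tabulate (lookup q)  ≡⟨ Vec.tabulate∘lookup q ⟩
  q                    ∎
  where
  open ≡-Reasoning
  open Inverse 2↔Bool using (to; from; strictlyInverseˡ)

  decode : ∀ s i → to (finToFun (subsetIndex s) i) ≡ lookup s i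
  decode s i = trans (cong to (finToFun-funToFin (from ∘ lookup s) i))
                     (strictlyInverseˡ (lookup s i))

  lookup-≗ : lookup p ≗ lookup q
  lookup-≗ i = begin
    lookup p i                       ≡⟨ decode p i ⟨
    to (finToFun (subsetIndex p) i)  ≡⟨ cong (λ c → to (finToFun {2} {n} c i)) eq ⟩
    to (finToFun (subsetIndex q) i)  ≡⟨ decode q i ⟩
    lookup q i                       ∎

size≤2^n : Hypergraph n m → m ≤ 2 ^ n
size≤2^n H = injective⇒≤ {f = subsetIndex ∘ edge H}
  (edge-injective H ∘ subsetIndex-injective)

greatest : {P : ℕ → Set} → Decidable P → ℕ → ℕ
greatest P? zero    = zero
greatest P? (suc b) = if does (P? (suc b)) then suc b else greatest P? b

greatest-upper : {P : ℕ → Set} (P? : Decidable P) → ∀ b {m} → m ≤ b → P m → m ≤ greatest P? b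
greatest-upper P? zero    m≤b p = m≤b
greatest-upper P? (suc b) m≤b p with P? (suc b) | ℕ.m≤n⇒m<n∨m≡n m≤b
... | yes _ | _                = m≤b
... | no ¬p | inj₁ (s≤s m≤b′) = greatest-upper P? b m≤b′ p
... | no ¬p | inj₂ refl       = contradiction p ¬p

greatest-holds : {P : ℕ → Set} (P? : Decidable P) → ∀ b {m} → m ≤ b → P m → P (greatest P? b)
greatest-holds P? zero    z≤n p = p
greatest-holds P? (suc b) m≤b p with P? (suc b) | ℕ.m≤n⇒m<n∨m≡n m≤b
... | yes q | _                = q
... | no ¬p | inj₁ (s≤s m≤b′) = greatest-holds P? b m≤b′ p
... | no ¬p | inj₂ refl       = contradiction p ¬p

-- The linear Turán number.  The next two lemmas say that it is the maximum of
-- the attainable edge numbers; it is 0 when there are none, which can happen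
-- only if F has no hyperedges.
exLin : (r n : ℕ) → Hypergraph k l → ℕ
exLin r n F = greatest (attainable? r n F) (2 ^ n)

exLin-upper : ∀ r n (F : Hypergraph k l) (H : Hypergraph n m) → Admissible r F H →
              m ≤ exLin r n F
exLin-upper r n F H adm = greatest-upper (attainable? r n F) (2 ^ n) (size≤2^n H) (H , adm)

exLin-attained : ∀ r n (F : Hypergraph k l) (H : Hypergraph n m) → Admissible r F H →
                 Attainable r n F (exLin r n F)
exLin-attained r n F H adm = greatest-holds (attainable? r n F) (2 ^ n) (size≤2^n H) (H , adm)

-- A Steiner system S(2,r,r²) is an affine plane: every point has degree r + 1, so it
-- has r (r + 1) blocks, and through a point off a block there is at most one block
-- disjoint from it.  In P₄ʳ the edges e₃ ≠ e₄ meet and are both disjoint from e₁, so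
-- no affine plane contains P₄ʳ.  As P₄ʳ is connected, n / r² disjoint copies of the
-- plane do not contain it either, and they have (r + 1) n / r edges.
module Submission where

open import Defs
import Algebra.Properties.Semiring.Sum as Sum
open import Data.Bool.Base using (Bool; true; false; _∧_; if_then_else_)
open import Data.Fin.Base using (Fin; zero; suc; _↑ˡ_; combine; remQuot)
open import Data.Fin.Patterns using (0F; 1F; 2F; 3F; 4F)
open import Data.Fin.Properties using (_≟_; any?; combine-remQuot)
open import Data.Fin.Subset using (Subset; _∈_; _∉_; _∩_; ∁; ⁅_⁆; ⊤; ⊥; ∣_∣; Nonempty)
open import Data.Fin.Subset.Properties
open import Data.Integer.Base using (+_)
import Data.Integer.Base as ℤ
import Data.Integer.Properties as ℤ
open import Data.Nat.Base
  using (ℕ; zero; suc; NonZero; _+_; _*_; _∸_; _^_; _≤_; _≥_; z≤n; s≤s; s≤s⁻¹)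
import Data.Nat.Properties as ℕ
open import Data.Nat.Divisibility using (_∣_; divides)
open import Data.Nat.Tactic.RingSolver using (solve-∀)
open import Data.Product using (∃!; ∃-syntax; _×_; _,_; proj₁; proj₂; uncurry)
import Data.Rational.Base as ℚ
import Data.Rational.Properties as ℚ
import Data.Rational.Unnormalised.Base as ℚᵘ
import Data.Rational.Unnormalised.Properties as ℚᵘ
open import Data.Vec.Base using (_∷_; []; _++_; concat; lookup; tabulate; here; there)
open import Data.Vec.Properties
  using (lookup-zipWith; lookup∘tabulate; lookup⇒[]=; []=⇒lookup;
         zipWith-++; ++-injectiveˡ; ++-injectiveʳ; map-replicate)
open import Function.Base using (_∘_)
open import Function.Definitions using (Injective)
open import Relation.Binary.PropositionalEquality
open import Relation.Nullary using (¬_; yes; no; does; contradiction)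
open import Relation.Nullary.Decidable using (dec-true; _×-dec_)

open Sum ℕ.+-*-semiring using (sum-syntax; sum-cong-≗; ∑-comm; *-distribˡ-sum; *-distribʳ-sum)

private
  variable
    k l m n q r v : ℕ

-- Cardinalities as sums of indicators, and double counting.

𝟙 : Bool → ℕ
𝟙 b = if b then 1 else 0

𝟙-∧ : ∀ a b → 𝟙 (a ∧ b) ≡ 𝟙 a * 𝟙 b
𝟙-∧ false b = refl
𝟙-∧ true  b = sym (ℕ.+-identityʳ (𝟙 b))

∣p∣≡∑𝟙 : (p : Subset n) → ∣ p ∣ ≡ ∑[ x < n ] 𝟙 (lookup p x)
∣p∣≡∑𝟙 []          = refl
∣p∣≡∑𝟙 (true  ∷ p) = cong suc (∣p∣≡∑𝟙 p)
∣p∣≡∑𝟙 (false ∷ p) = ∣p∣≡∑𝟙 p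

∣p∩q∣≡∑𝟙*𝟙 : (p q : Subset n) → ∣ p ∩ q ∣ ≡ ∑[ x < n ] (𝟙 (lookup p x) * 𝟙 (lookup q x))
∣p∩q∣≡∑𝟙*𝟙 p q = trans (∣p∣≡∑𝟙 (p ∩ q)) (sum-cong-≗ λ x →
  trans (cong 𝟙 (lookup-zipWith _∧_ x p q)) (𝟙-∧ (lookup p x) (lookup q x)))

-- Membership in `S` enters as a 0/1 factor, so that sums over subsets stay sums over all indices
-- and `∑-comm` can exchange them.
sumOver : Subset n → (Fin n → ℕ) → ℕ
sumOver {n} S f = ∑[ i < n ] (𝟙 (lookup S i) * f i)

sum-mono : {f g : Fin n → ℕ} → (∀ i → f i ≤ g i) → ∑[ i < n ] f i ≤ ∑[ i < n ] g i
sum-mono {zero}  f≤g = z≤n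
sum-mono {suc n} f≤g = ℕ.+-mono-≤ (f≤g zero) (sum-mono (f≤g ∘ suc))

sumOver-const : (S : Subset n) (c : ℕ) → sumOver S (λ _ → c) ≡ ∣ S ∣ * c
sumOver-const S c = trans (sym (*-distribʳ-sum c (𝟙 ∘ lookup S))) (cong (_* c) (sym (∣p∣≡∑𝟙 S)))

sumOver-mono : (S : Subset n) {f g : Fin n → ℕ} → (∀ {i} → i ∈ S → f i ≤ g i) →
               sumOver S f ≤ sumOver S g
sumOver-mono S {f} {g} f≤g = sum-mono step
  where
  step : ∀ i → 𝟙 (lookup S i) * f i ≤ 𝟙 (lookup S i) * g i
  step i with lookup S i in eq
  ... | false = z≤n
  ... | true  = ℕ.+-monoˡ-≤ 0 (f≤g (lookup⇒[]= i S eq))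

sumOver-≤ : (S : Subset n) {f : Fin n → ℕ} {c : ℕ} → (∀ {i} → i ∈ S → f i ≤ c) →
            sumOver S f ≤ ∣ S ∣ * c
sumOver-≤ S {c = c} f≤c = subst (sumOver S _ ≤_) (sumOver-const S c) (sumOver-mono S f≤c)

sumOver-≡ : (S : Subset n) {f : Fin n → ℕ} {c : ℕ} → (∀ {i} → i ∈ S → f i ≡ c) →
            sumOver S f ≡ ∣ S ∣ * c
sumOver-≡ S {c = c} f≡c = ℕ.≤-antisym (sumOver-≤ S (ℕ.≤-reflexive ∘ f≡c))
  (subst (_≤ sumOver S _) (sumOver-const S c) (sumOver-mono S (ℕ.≤-reflexive ∘ sym ∘ f≡c)))

-- The column of `x` in the incidence matrix whose rows are the `M i`.
pencil : (Fin m → Subset n) → Fin n → Subset m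
pencil M x = tabulate λ i → lookup (M i) x

∈-pencil⁺ : (M : Fin m → Subset n) {i : Fin m} {x : Fin n} → x ∈ M i → i ∈ pencil M x
∈-pencil⁺ M {i} x∈Mi = lookup⇒[]= i _ (trans (lookup∘tabulate _ i) ([]=⇒lookup x∈Mi))

∈-pencil⁻ : (M : Fin m → Subset n) {i : Fin m} {x : Fin n} → i ∈ pencil M x → x ∈ M i
∈-pencil⁻ M {i} i∈ = lookup⇒[]= _ (M i) (trans (sym (lookup∘tabulate _ i)) ([]=⇒lookup i∈))

-- Both sides count the pairs `(i , x)` with `i ∈ S`, `x ∈ Q` and `x ∈ M i`. The freedom in `S` and
-- `Q` lets this serve the degrees, the number of blocks and the parallels alike.
double-count : (M : Fin m → Subset n) (S : Subset m) (Q : Subset n) →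
               sumOver S (λ i → ∣ M i ∩ Q ∣) ≡ sumOver Q (λ x → ∣ S ∩ pencil M x ∣)
double-count {m} {n} M S Q = begin
  ∑[ i < m ] (s i * ∣ M i ∩ Q ∣)
    ≡⟨ sum-cong-≗ (λ i → trans (cong (s i *_) (∣p∩q∣≡∑𝟙*𝟙 (M i) Q))
                                  (*-distribˡ-sum (s i) λ x → a i x * t x)) ⟩
  ∑[ i < m ] ∑[ x < n ] (s i * (a i x * t x))
    ≡⟨ ∑-comm (λ i x → s i * (a i x * t x)) ⟩
  ∑[ x < n ] ∑[ i < m ] (s i * (a i x * t x))
    ≡⟨ sum-cong-≗ (λ x → sum-cong-≗ λ i → rotate (s i) (a i x) (t x)) ⟩
  ∑[ x < n ] ∑[ i < m ] (t x * (s i * a i x))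
    ≡⟨ sum-cong-≗ (λ x → trans (sym (*-distribˡ-sum (t x) λ i → s i * a i x))
                                  (cong (t x *_) (sym (inner x)))) ⟩
  ∑[ x < n ] (t x * ∣ S ∩ pencil M x ∣) ∎
  where
  open ≡-Reasoning
  s = λ i → 𝟙 (lookup S i)
  t = λ x → 𝟙 (lookup Q x)
  a = λ i x → 𝟙 (lookup (M i) x)

  rotate : ∀ a b c → a * (b * c) ≡ c * (a * b)
  rotate = solve-∀

  inner : ∀ x → ∣ S ∩ pencil M x ∣ ≡ ∑[ i < m ] (s i * a i x)
  inner x = trans (∣p∩q∣≡∑𝟙*𝟙 S (pencil M x)) (sum-cong-≗ λ i →
    cong ((s i *_) ∘ 𝟙) (lookup∘tabulate (λ i → lookup (M i) x) i))

-- Nonempty subsets, singletons and the removal of a point.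

x∈p⇒p≢⊥ : {x : Fin n} {p : Subset n} → x ∈ p → p ≢ ⊥
x∈p⇒p≢⊥ x∈p refl = ∉⊥ x∈p

p≢⊥⇒Nonempty : (p : Subset n) → p ≢ ⊥ → Nonempty p
p≢⊥⇒Nonempty p p≢⊥ with nonempty? p
... | yes ne = ne
... | no ¬ne = contradiction (Empty-unique ¬ne) p≢⊥

-- The removal of `x` is written as an intersection, which is the shape that `double-count` takes
-- with `Q = ∁ ⁅ x ⁆`.
∣p∣≡1+∣p∩∁⁅x⁆∣ : {x : Fin n} {p : Subset n} → x ∈ p → ∣ p ∣ ≡ suc ∣ p ∩ ∁ ⁅ x ⁆ ∣
∣p∣≡1+∣p∩∁⁅x⁆∣ {p = _ ∷ p} here = cong (suc ∘ ∣_∣) (sym (trans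
  (cong (p ∩_) (map-replicate _ _ _)) (∩-identityʳ p)))
∣p∣≡1+∣p∩∁⁅x⁆∣ {p = true  ∷ p} (there x∈p) = cong suc (∣p∣≡1+∣p∩∁⁅x⁆∣ x∈p)
∣p∣≡1+∣p∩∁⁅x⁆∣ {p = false ∷ p} (there x∈p) = ∣p∣≡1+∣p∩∁⁅x⁆∣ x∈p

x∉∁⁅x⁆ : (x : Fin n) → x ∉ ∁ ⁅ x ⁆
x∉∁⁅x⁆ x = x∈p⇒x∉∁p (x∈⁅x⁆ x)

x≢y⇒x∈∁⁅y⁆ : {x y : Fin n} → x ≢ y → x ∈ ∁ ⁅ y ⁆
x≢y⇒x∈∁⁅y⁆ x≢y = x∉p⇒x∈∁p (x≢y⇒x∉⁅y⁆ x≢y)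

∃!⇒∣p∣≡1 : {x : Fin n} {p : Subset n} → x ∈ p → (∀ {y} → y ∈ p → x ≡ y) → ∣ p ∣ ≡ 1
∃!⇒∣p∣≡1 {x = x} {p} x∈p unique = trans (cong ∣_∣ (⊆-antisym
  (λ y∈p → subst (_∈ ⁅ x ⁆) (unique y∈p) (x∈⁅x⁆ x))
  (λ y∈⁅x⁆ → subst (_∈ p) (sym (x∈⁅y⁆⇒x≡y x y∈⁅x⁆)) x∈p))) (∣⁅x⁆∣≡1 x)

-- Steiner systems: linearity, degrees, number of blocks, parallels.

module Steiner (B : Hypergraph v m) (uniform : Uniform r B)
  (join : ∀ {x y} → x ≢ y → ∃! _≡_ λ i → x ∈ edge B i × y ∈ edge B i) where

  degree : Fin v → ℕ
  degree x = ∣ pencil (edge B) x ∣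

  join-unique : ∀ {x y i j} → x ≢ y → x ∈ edge B i → y ∈ edge B i →
                x ∈ edge B j → y ∈ edge B j → i ≡ j
  join-unique x≢y xi yi xj yj = let _ , _ , unique = join x≢y in
    trans (sym (unique (xi , yi))) (unique (xj , yj))

  -- If points `x ≢ y` lay on both blocks, uniqueness of the join would identify the blocks. So a
  -- nonempty intersection is a singleton.
  linear : Linear B
  linear {i} {j} i≢j with nonempty? (edge B i ∩ edge B j)
  ... | no ¬ne = subst (_≤ 1) (sym (trans (cong ∣_∣ (Empty-unique ¬ne)) (∣⊥∣≡0 v))) z≤n
  ... | yes (x , x∈) = ℕ.≤-reflexive (∃!⇒∣p∣≡1 x∈ same)
    where
    same : ∀ {y} → y ∈ edge B i ∩ edge B j → x ≡ y
    same {y} y∈ with x ≟ y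
    ... | yes x≡y = x≡y
    ... | no  x≢y = let xi , xj = x∈p∩q⁻ _ _ x∈ ; yi , yj = x∈p∩q⁻ _ _ y∈ in
      contradiction (join-unique x≢y xi yi xj yj) i≢j

  -- The only member is the block joining `x` and `y`. `S` may be any set of blocks through `x` that
  -- keeps this join: the whole pencil of `x` for the degrees, the pencil less two blocks for the
  -- parallels.
  ∣S∩pencil∣≡1 : ∀ {x y S} → x ≢ y →
                 (∀ {i} → i ∈ S → x ∈ edge B i) →
                 (∀ {i} → x ∈ edge B i → y ∈ edge B i → i ∈ S) →
                 ∣ S ∩ pencil (edge B) y ∣ ≡ 1
  ∣S∩pencil∣≡1 {S = S} x≢y ⊆ ⊇ = let _ , (xi , yi) , unique = join x≢y in
    ∃!⇒∣p∣≡1 (x∈p∩q⁺ (⊇ xi yi , ∈-pencil⁺ (edge B) yi))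
      λ j∈ → let j∈S , j∈y = x∈p∩q⁻ S _ j∈ in unique (⊆ j∈S , ∈-pencil⁻ (edge B) j∈y)

  -- Count the pairs of a block through `x` and a point `y ≢ x` on it: each such block has `r ∸ 1`
  -- such points, and each `y` lies on exactly one of these blocks.
  degree*[r∸1]≡v∸1 : ∀ x → degree x * (r ∸ 1) ≡ v ∸ 1
  degree*[r∸1]≡v∸1 x = begin
    degree x * (r ∸ 1)
      ≡⟨ sumOver-≡ (pencil (edge B) x) (λ {i} i∈ →
           trans (cong (_∸ 1) (sym (∣p∣≡1+∣p∩∁⁅x⁆∣ (∈-pencil⁻ (edge B) i∈))))
                 (cong (_∸ 1) (uniform i))) ⟨
    sumOver (pencil (edge B) x) (λ i → ∣ edge B i ∩ ∁ ⁅ x ⁆ ∣)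
      ≡⟨ double-count (edge B) (pencil (edge B) x) (∁ ⁅ x ⁆) ⟩
    sumOver (∁ ⁅ x ⁆) (λ y → ∣ pencil (edge B) x ∩ pencil (edge B) y ∣)
      ≡⟨ sumOver-≡ (∁ ⁅ x ⁆) (λ y∈ → ∣S∩pencil∣≡1 (λ { refl → x∉∁⁅x⁆ x y∈ })
           (∈-pencil⁻ (edge B)) (λ xi _ → ∈-pencil⁺ (edge B) xi)) ⟩
    ∣ ∁ ⁅ x ⁆ ∣ * 1
      ≡⟨ ℕ.*-identityʳ _ ⟩
    ∣ ∁ ⁅ x ⁆ ∣
      ≡⟨ trans (∣∁p∣≡n∸∣p∣ ⁅ x ⁆) (cong (v ∸_) (∣⁅x⁆∣≡1 x)) ⟩
    v ∸ 1 ∎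
    where open ≡-Reasoning

  -- Count all incident pairs of a point and a block in two ways.
  m*r≡v*d : ∀ {d} → (∀ x → degree x ≡ d) → m * r ≡ v * d
  m*r≡v*d {d} regular = begin
    m * r
      ≡⟨ cong (_* r) (∣⊤∣≡n m) ⟨
    ∣ ⊤ {m} ∣ * r
      ≡⟨ sumOver-≡ ⊤ (λ {i} _ → trans (cong ∣_∣ (∩-identityʳ (edge B i))) (uniform i)) ⟨
    sumOver ⊤ (λ i → ∣ edge B i ∩ ⊤ ∣)
      ≡⟨ double-count (edge B) ⊤ ⊤ ⟩
    sumOver ⊤ (λ x → ∣ ⊤ ∩ pencil (edge B) x ∣)
      ≡⟨ sumOver-≡ ⊤ (λ {x} _ → trans (cong ∣_∣ (∩-identityˡ (pencil (edge B) x))) (regular x)) ⟩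
    ∣ ⊤ {v} ∣ * d
      ≡⟨ cong (_* d) (∣⊤∣≡n v) ⟩
    v * d ∎
    where open ≡-Reasoning

  -- Each point of b lies on exactly one block through x, so r of the at most r + 1
  -- blocks through x meet b and at most one is disjoint from it.
  parallel-unique : ∀ {x b} → x ∉ edge B b → degree x ≤ suc r →
                    ∀ {i j} → x ∈ edge B i → x ∈ edge B j →
                    edge B b ∩ edge B i ≡ ⊥ → edge B b ∩ edge B j ≡ ⊥ → i ≡ j
  parallel-unique {x} {b} x∉b deg≤ {i} {j} xi xj b∥i b∥j with i ≟ j
  ... | yes i≡j = i≡j
  ... | no  i≢j = contradiction r≤∣S∣ (ℕ.<⇒≱ ∣S∣<r)
    where
    P S : Subset m
    P = pencil (edge B) x
    S = (P ∩ ∁ ⁅ i ⁆) ∩ ∁ ⁅ j ⁆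

    2+∣S∣≡degree : degree x ≡ suc (suc ∣ S ∣)
    2+∣S∣≡degree = trans (∣p∣≡1+∣p∩∁⁅x⁆∣ (∈-pencil⁺ (edge B) xi)) (cong suc
      (∣p∣≡1+∣p∩∁⁅x⁆∣ (x∈p∩q⁺ (∈-pencil⁺ (edge B) xj , x≢y⇒x∈∁⁅y⁆ (i≢j ∘ sym)))))

    ∣S∣<r : suc ∣ S ∣ ≤ r
    ∣S∣<r = s≤s⁻¹ (subst (_≤ suc r) 2+∣S∣≡degree deg≤)

    meets : ∀ {c y} → y ∈ edge B b → y ∈ edge B c → edge B b ∩ edge B c ≢ ⊥
    meets yb yc = x∈p⇒p≢⊥ (x∈p∩q⁺ (yb , yc))

    S⊆P : ∀ {c} → c ∈ S → x ∈ edge B c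
    S⊆P c∈S = ∈-pencil⁻ (edge B) (p∩q⊆p P _ (p∩q⊆p (P ∩ ∁ ⁅ i ⁆) _ c∈S))

    -- A block meeting `b` is neither `i` nor `j`, so removing these two loses no join of `x` with a
    -- point of `b`.
    ∈S : ∀ {c y} → y ∈ edge B b → x ∈ edge B c → y ∈ edge B c → c ∈ S
    ∈S yb xc yc = x∈p∩q⁺ (x∈p∩q⁺ (∈-pencil⁺ (edge B) xc ,
      x≢y⇒x∈∁⁅y⁆ λ { refl → meets yb yc b∥i }) , x≢y⇒x∈∁⁅y⁆ λ { refl → meets yb yc b∥j })

    open ℕ.≤-Reasoning

    r≤∣S∣ : r ≤ ∣ S ∣
    r≤∣S∣ = begin
      r
        ≡⟨ trans (ℕ.*-identityʳ _) (uniform b) ⟨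
      ∣ edge B b ∣ * 1
        ≡⟨ sumOver-≡ (edge B b) (λ yb → ∣S∩pencil∣≡1 (λ { refl → x∉b yb }) S⊆P (∈S yb)) ⟨
      sumOver (edge B b) (λ y → ∣ S ∩ pencil (edge B) y ∣)
        ≡⟨ double-count (edge B) S (edge B b) ⟨
      sumOver S (λ c → ∣ edge B c ∩ edge B b ∣)
        -- A block of `S` contains `x`, so it is not `b`, and linearity leaves it at most one point
        -- of `b`.
        ≤⟨ sumOver-≤ S (λ c∈S → linear λ { refl → x∉b (S⊆P c∈S) }) ⟩
      ∣ S ∣ * 1
        ≡⟨ ℕ.*-identityʳ _ ⟩
      ∣ S ∣ ∎

-- Disjoint copies of a hypergraph.

∣p++q∣≡∣p∣+∣q∣ : (p : Subset m) (q : Subset n) → ∣ p ++ q ∣ ≡ ∣ p ∣ + ∣ q ∣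
∣p++q∣≡∣p∣+∣q∣ []          q = refl
∣p++q∣≡∣p∣+∣q∣ (true  ∷ p) q = cong suc (∣p++q∣≡∣p∣+∣q∣ p q)
∣p++q∣≡∣p∣+∣q∣ (false ∷ p) q = ∣p++q∣≡∣p∣+∣q∣ p q

⊥++⊥≡⊥ : ∀ m {n} → ⊥ {m} ++ ⊥ {n} ≡ ⊥
⊥++⊥≡⊥ zero    = refl
⊥++⊥≡⊥ (suc m) = cong (false ∷_) (⊥++⊥≡⊥ m)

++-∩ : (p p′ : Subset m) (q q′ : Subset n) → (p ++ q) ∩ (p′ ++ q′) ≡ (p ∩ p′) ++ (q ∩ q′)
++-∩ p p′ q q′ = zipWith-++ _∧_ p q p′ q′

++-disjoint : (p p′ : Subset m) (q q′ : Subset n) → p ∩ p′ ≡ ⊥ → q ∩ q′ ≡ ⊥ →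
              (p ++ q) ∩ (p′ ++ q′) ≡ ⊥
++-disjoint {m} p p′ q q′ p∩p′≡⊥ q∩q′≡⊥ =
  trans (++-∩ p p′ q q′) (trans (cong₂ _++_ p∩p′≡⊥ q∩q′≡⊥) (⊥++⊥≡⊥ m))

-- `Fin (q * v)` is cut into `q` segments of length `v`, one for each copy. Padding with `⊥` by
-- `_++_` lets sizes and intersections be computed segment by segment.
place : Fin q → Subset v → Subset (q * v)
place {suc q} zero    e = e ++ ⊥
place {suc q} (suc c) e = ⊥ ++ place c e

∣place∣ : (c : Fin q) (e : Subset v) → ∣ place c e ∣ ≡ ∣ e ∣
∣place∣ {suc q} {v} zero    e = trans (∣p++q∣≡∣p∣+∣q∣ e ⊥)
  (trans (cong₂ _+_ (refl {x = ∣ e ∣}) (∣⊥∣≡0 (q * v))) (ℕ.+-identityʳ _))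
∣place∣ {suc q} {v} (suc c) e = trans (∣p++q∣≡∣p∣+∣q∣ (⊥ {v}) (place c e))
  (cong₂ _+_ (∣⊥∣≡0 v) (∣place∣ c e))

place-injective : (c : Fin q) → Injective _≡_ _≡_ (place {v = v} c)
place-injective zero    eq = ++-injectiveˡ _ _ eq
place-injective (suc c) eq = place-injective c (++-injectiveʳ ⊥ ⊥ eq)

place-⊥ : (c : Fin q) → place {v = v} c ⊥ ≡ ⊥
place-⊥ {v = v} zero    = ⊥++⊥≡⊥ v
place-⊥ {v = v} (suc c) = trans (cong (⊥ {v} ++_) (place-⊥ c)) (⊥++⊥≡⊥ v)

place-∩ : (c : Fin q) (e e′ : Subset v) → place c e ∩ place c e′ ≡ place c (e ∩ e′)
place-∩ {v = v} (zero {q}) e e′ =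
  trans (++-∩ e e′ ⊥ ⊥) (cong ((e ∩ e′) ++_) (∩-idem (⊥ {q * v})))
place-∩ {v = v} (suc c) e e′ =
  trans (++-∩ (⊥ {v}) ⊥ (place c e) (place c e′)) (cong₂ _++_ (∩-idem (⊥ {v})) (place-∩ c e e′))

place-disjoint : {c d : Fin q} → c ≢ d → (e e′ : Subset v) → place c e ∩ place d e′ ≡ ⊥
place-disjoint {c = zero}  {zero}  c≢d e e′ = contradiction refl c≢d
place-disjoint {c = zero}  {suc d} c≢d e e′ =
  ++-disjoint e ⊥ ⊥ (place d e′) (∩-zeroʳ e) (∩-zeroˡ (place d e′))
place-disjoint {c = suc c} {zero}  c≢d e e′ =
  ++-disjoint ⊥ e′ (place c e) ⊥ (∩-zeroˡ e′) (∩-zeroʳ (place c e))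
place-disjoint {v = v} {c = suc c} {suc d} c≢d e e′ =
  ++-disjoint (⊥ {v}) ⊥ (place c e) (place d e′) (∩-idem (⊥ {v}))
    (place-disjoint (c≢d ∘ cong suc) e e′)

-- Distinct copies have no vertex in common. This is what confines a connected subhypergraph to one
-- copy.
place-meets : {c d : Fin q} {e e′ : Subset v} → place c e ∩ place d e′ ≢ ⊥ → c ≡ d × e ∩ e′ ≢ ⊥
place-meets {c = c} {d} {e} {e′} meets with c ≟ d
... | no  c≢d  = contradiction (place-disjoint c≢d e e′) meets
... | yes refl = refl , λ e∩e′≡⊥ →
  meets (trans (place-∩ c e e′) (trans (cong (place c) e∩e′≡⊥) (place-⊥ c)))

place-∩-⊥⁻ : (c : Fin q) {e e′ : Subset v} → place c e ∩ place c e′ ≡ ⊥ → e ∩ e′ ≡ ⊥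
place-∩-⊥⁻ c {e} {e′} eq =
  place-injective c (trans (sym (place-∩ c e e′)) (trans eq (sym (place-⊥ c))))

module Copies (q : ℕ) (B : Hypergraph v m) (uniform : Uniform (suc r) B) where

  copyEdge : Fin q × Fin m → Subset (q * v)
  copyEdge (c , i) = place c (edge B i)

  edge≢⊥ : ∀ i → edge B i ≢ ⊥
  edge≢⊥ i eq with trans (sym (uniform i)) (trans (cong ∣_∣ eq) (∣⊥∣≡0 v))
  ... | ()

  copyEdge≢⊥ : ∀ a → copyEdge a ≢ ⊥
  copyEdge≢⊥ (c , i) eq = edge≢⊥ i (place-injective c (trans eq (sym (place-⊥ c))))

  -- All copies of an empty edge would coincide, but edges here have `suc r` vertices. Equal copied
  -- edges therefore meet, and `place-meets` puts them in the same copy.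
  copyEdge-injective : Injective _≡_ _≡_ copyEdge
  copyEdge-injective {a@(c , i)} {b@(d , j)} eq
    with refl , _ ← place-meets {c = c} {d} {edge B i} {edge B j}
                      (copyEdge≢⊥ a ∘ trans (trans (sym (∩-idem _)) (cong (copyEdge a ∩_) eq)))
    = cong (c ,_) (edge-injective B (place-injective c eq))

  remQuot-injective : Injective _≡_ _≡_ (remQuot {q} m)
  remQuot-injective {x} {y} eq = trans (sym (combine-remQuot {q} m x))
    (trans (cong (uncurry combine) eq) (combine-remQuot {q} m y))

  copies : Hypergraph (q * v) (q * m)
  copies = record
    { edge           = copyEdge ∘ remQuot m
    ; edge-injective = remQuot-injective ∘ copyEdge-injective
    }

  copies-uniform : Uniform (suc r) copies
  copies-uniform k = let c , i = remQuot {q} m k in trans (∣place∣ c (edge B i)) (uniform i)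

  copyEdge-linear : Linear B → ∀ a b → a ≢ b → ∣ copyEdge a ∩ copyEdge b ∣ ≤ 1
  copyEdge-linear lin (c , i) (d , j) a≢b with c ≟ d
  ... | no  c≢d  = subst (_≤ 1)
    (sym (trans (cong ∣_∣ (place-disjoint c≢d (edge B i) (edge B j))) (∣⊥∣≡0 (q * v)))) z≤n
  ... | yes refl = subst (_≤ 1)
    (sym (trans (cong ∣_∣ (place-∩ c (edge B i) (edge B j))) (∣place∣ c _)))
    (lin (a≢b ∘ cong (c ,_)))

  copies-linear : Linear B → Linear copies
  copies-linear lin {k} {l} k≢l =
    copyEdge-linear lin (remQuot m k) (remQuot m l) (k≢l ∘ remQuot-injective)

-- Expanded paths and how to exclude them.

-- Disjointness is written as parallelism.  Within one affine plane only c ∦ d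
-- matters; the other two conditions force all four edges into the same copy.
NoParallelPath : Hypergraph n m → Set
NoParallelPath H = ∀ {a b c d} → let _∥_ = λ i j → edge H i ∩ edge H j ≡ ⊥ in
  ¬ a ∥ b → ¬ b ∥ c → ¬ c ∥ d → a ∥ c → a ∥ d → c ≡ d

∈-image⁺ : (f : Fin k → Fin n) {e : Subset k} {x : Fin k} → x ∈ e → f x ∈ image f e
∈-image⁺ f {e} {x} x∈e = lookup⇒[]= (f x) _ (trans (lookup∘tabulate _ (f x))
  (dec-true (any? λ z → (z ∈? e) ×-dec (f z ≟ f x)) (x , x∈e , refl)))

∈-image⁻ : (f : Fin k → Fin n) {e : Subset k} {y : Fin n} → y ∈ image f e →
           ∃[ x ] x ∈ e × f x ≡ y
∈-image⁻ f {e} {y} y∈ with any? (λ z → (z ∈? e) ×-dec (f z ≟ y))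
                         | trans (sym (lookup∘tabulate _ y)) ([]=⇒lookup y∈)
... | yes p | _ = p
... | no  _ | ()

∈-image-injective⁻ : {f : Fin k → Fin n} → Injective _≡_ _≡_ f →
                     {e : Subset k} {x : Fin k} → f x ∈ image f e → x ∈ e
∈-image-injective⁻ {f = f} inj {e} fx∈ with z , z∈e , fz≡fx ← ∈-image⁻ f fx∈ =
  subst (_∈ e) (inj fz≡fx) z∈e

image-disjoint : {f : Fin k → Fin n} → Injective _≡_ _≡_ f → {e e′ : Subset k} →
                 e ∩ e′ ≡ ⊥ → image f e ∩ image f e′ ≡ ⊥
image-disjoint {f = f} inj {e} {e′} e∩e′≡⊥ = Empty-unique empty
  where
  empty : ¬ Nonempty (image f e ∩ image f e′)
  empty (y , y∈) with y∈₁ , y∈₂ ← x∈p∩q⁻ _ _ y∈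
                 with x , x∈e , refl ← ∈-image⁻ f {e} y∈₁
    = x∈p⇒p≢⊥ (x∈p∩q⁺ (x∈e , ∈-image-injective⁻ inj y∈₂)) e∩e′≡⊥

concat-disjoint : ∀ m (g h : Fin m → Subset n) → (∀ k → g k ∩ h k ≡ ⊥) →
                  concat (tabulate g) ∩ concat (tabulate h) ≡ ⊥
concat-disjoint zero    g h g∩h≡⊥ = refl
concat-disjoint (suc m) g h g∩h≡⊥ = ++-disjoint (g zero) (h zero) _ _
  (g∩h≡⊥ zero) (concat-disjoint m (g ∘ suc) (h ∘ suc) (g∩h≡⊥ ∘ suc))

-- Distinct edges receive disjoint blocks of new vertices, so a common vertex could only be a vertex
-- of `G`.
expansion-disjoint : ∀ r (G : Graph k m) {i j} → i ≢ j →
                     edge (proj₁ G) i ∩ edge (proj₁ G) j ≡ ⊥ →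
                     edge (expansion r G) i ∩ edge (expansion r G) j ≡ ⊥
expansion-disjoint {m = m} r (G , _) {i} {j} i≢j disjoint =
  ++-disjoint (edge G i) (edge G j) _ _ disjoint (concat-disjoint m _ _ blocks)
  where
  blocks : ∀ x → (if does (i ≟ x) then ⊤ else ⊥ {r ∸ 2}) ∩ (if does (j ≟ x) then ⊤ else ⊥) ≡ ⊥
  blocks x with i ≟ x | j ≟ x
  ... | yes refl | yes refl = contradiction refl i≢j
  ... | yes _    | no _     = ∩-zeroʳ _
  ... | no _     | _        = ∩-zeroˡ _

∈-++⁺ˡ : {x : Fin m} {p : Subset m} {q : Subset n} → x ∈ p → (x ↑ˡ n) ∈ p ++ q
∈-++⁺ˡ here        = here
∈-++⁺ˡ (there x∈p) = there (∈-++⁺ˡ x∈p)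

-- The vertices `1F`, `2F`, `3F` make the images of consecutive edges meet, and the image of the
-- first edge misses those of the third and fourth. So the last two images would be equal, although
-- the end vertex `4F` of the path lies only in the fourth edge.
noParallelPath⇒P₄-free : ∀ r (H : Hypergraph n m) → NoParallelPath H → Free (expansion r P₄) H
noParallelPath⇒P₄-free {m = m} r H noPath (f , inj , hit) =
  last∉third (subst (λ i → f v₄ ∈ edge H i) (sym third≡fourth)
    (at {3F} {4F} (there (there (there (there here))))))
  where
  F = expansion r P₄

  j : Fin 4 → Fin m
  j i = proj₁ (hit i)

  at : ∀ {i x} → x ∈ edge (proj₁ P₄) i → f (x ↑ˡ (4 * (r ∸ 2))) ∈ edge H (j i)
  at {i} {x} x∈ = subst (f (x ↑ˡ (4 * (r ∸ 2))) ∈_) (proj₂ (hit i))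
    (∈-image⁺ f {edge F i} (∈-++⁺ˡ x∈))

  share : ∀ {i i′} x → x ∈ edge (proj₁ P₄) i → x ∈ edge (proj₁ P₄) i′ →
          edge H (j i) ∩ edge H (j i′) ≢ ⊥
  share x x∈ x∈′ = x∈p⇒p≢⊥ (x∈p∩q⁺ (at x∈ , at x∈′))

  apart : ∀ {i i′} → i ≢ i′ → edge (proj₁ P₄) i ∩ edge (proj₁ P₄) i′ ≡ ⊥ →
          edge H (j i) ∩ edge H (j i′) ≡ ⊥
  apart {i} {i′} i≢i′ disjoint = subst₂ (λ e e′ → e ∩ e′ ≡ ⊥) (proj₂ (hit i)) (proj₂ (hit i′))
    (image-disjoint inj (expansion-disjoint r P₄ i≢i′ disjoint))

  v₄ : Fin (5 + 4 * (r ∸ 2))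
  v₄ = _↑ˡ_ {5} 4F (4 * (r ∸ 2))

  third≡fourth : j 2F ≡ j 3F
  third≡fourth = noPath
    (share {0F} {1F} 1F (there here) (there here))
    (share {1F} {2F} 2F (there (there here)) (there (there here)))
    (share {2F} {3F} 3F (there (there (there here))) (there (there (there here))))
    (apart {0F} {2F} (λ ()) refl) (apart {0F} {3F} (λ ()) refl)

  last∉third : f v₄ ∉ edge H (j 2F)
  last∉third 4∈
    -- `4F` is an old vertex, so the entry of the third edge there computes to `false` for every
    -- `r`.
    with ()  ← []=⇒lookup (∈-image-injective⁻ inj {edge F 2F} {v₄}
                 (subst (f v₄ ∈_) (sym (proj₂ (hit 2F))) 4∈))

-- The affine plane and its copies contain no forbidden path.

module AffinePlane (s : ℕ) .{{_ : NonZero s}} (B : Hypergraph (suc s ^ 2) m)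
  (uniform : Uniform (suc s) B)
  (join : ∀ {x y} → x ≢ y → ∃! _≡_ λ i → x ∈ edge B i × y ∈ edge B i) where

  open Steiner B uniform join public

  -- With `r = suc s`, there are `r ^ 2 ∸ 1 = (r + 1) * s` points other than `x`, and each block
  -- through `x` has `s` of them. `NonZero s` permits cancelling `s`.
  degree≡r+1 : ∀ x → degree x ≡ suc (suc s)
  degree≡r+1 x = ℕ.*-cancelʳ-≡ _ _ s (trans (degree*[r∸1]≡v∸1 x) (square s))
    where
    square : ∀ s → suc s ^ 2 ∸ 1 ≡ suc (suc s) * s
    -- The identity is solved with 1 added to both sides, which keeps `∸` away from the ring solver.
    square s = cong (_∸ 1) (expand s)
      where
      expand : ∀ s → suc s * (suc s * 1) ≡ suc (suc (suc s) * s)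
      expand = solve-∀

  -- This amounts to `r * (r + 1)` blocks for `r = suc s`. The common factor `r` is left in, since
  -- the final bound is compared after multiplying by its denominator `r`.
  size : m * suc s ≡ suc s ^ 2 * suc (suc s)
  size = m*r≡v*d degree≡r+1

  -- A common point `x` of `c` and `d` is off `a`, because `a` and `c` are disjoint. Hence `c` and
  -- `d` are both the parallel to `a` through `x`.
  noParallelPath : NoParallelPath B
  noParallelPath {a} {b} {c} {d} _ _ c∩d≢⊥ a∥c a∥d
    with x , x∈ ← p≢⊥⇒Nonempty (edge B c ∩ edge B d) c∩d≢⊥
    with xc , xd ← x∈p∩q⁻ (edge B c) _ x∈
    = parallel-unique (λ xa → x∈p⇒p≢⊥ (x∈p∩q⁺ (xa , xc)) a∥c)
        (ℕ.≤-reflexive (degree≡r+1 x)) xc xd a∥c a∥d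

-- Consecutive edges of the chain `a`, `b`, `c`, `d` meet, so three uses of `place-meets` bring all
-- four into one copy, where the property of `B` applies.
copies-noParallelPath : ∀ q (B : Hypergraph v m) (uniform : Uniform (suc r) B) →
                        NoParallelPath B → NoParallelPath (Copies.copies q B uniform)
copies-noParallelPath {m = m} q B uniform noPath a∦b b∦c c∦d a∥c a∥d = remQuot-injective
  (noCopyPath (remQuot m _) (remQuot m _) (remQuot m _) (remQuot m _) a∦b b∦c c∦d a∥c a∥d)
  where
  open Copies q B uniform

  noCopyPath : ∀ a b c d → let _∥_ = λ i j → copyEdge i ∩ copyEdge j ≡ ⊥ in
               ¬ a ∥ b → ¬ b ∥ c → ¬ c ∥ d → a ∥ c → a ∥ d → c ≡ d
  noCopyPath (t , i) (u , j) (w , k) (z , l) a∦b b∦c c∦d a∥c a∥d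
    with refl , i∦j ← place-meets {c = t} {u} {edge B i} {edge B j} a∦b
    with refl , j∦k ← place-meets {c = u} {w} {edge B j} {edge B k} b∦c
    with refl , k∦l ← place-meets {c = w} {z} {edge B k} {edge B l} c∦d
    = cong (t ,_) (noPath i∦j j∦k k∦l (place-∩-⊥⁻ t a∥c) (place-∩-⊥⁻ t a∥d))

-- The bound as an inequality of rationals.

-- Cross-multiplication, carried out on unnormalised fractions because `ℚ./` reduces to lowest
-- terms.
/-≤ : ∀ a b c d .{{_ : NonZero c}} .{{_ : NonZero d}} → a * d ≤ b * c →
      (+ a) ℚ./ c ℚ.≤ (+ b) ℚ./ d
/-≤ a b (suc c) (suc d) ad≤bc = ℚ.toℚᵘ-cancel-≤
  (ℚᵘ.≤-respˡ-≃ (ℚᵘ.≃-sym (ℚ.toℚᵘ-fromℚᵘ (ℚᵘ.mkℚᵘ (+ a) c)))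
  (ℚᵘ.≤-respʳ-≃ (ℚᵘ.≃-sym (ℚ.toℚᵘ-fromℚᵘ (ℚᵘ.mkℚᵘ (+ b) d)))
  (ℚᵘ.*≤* (subst₂ ℤ._≤_ (ℤ.pos-* a (suc d)) (ℤ.pos-* b (suc c)) (ℤ.+≤+ ad≤bc)))))

theorem5 : (r n : ℕ) → .{{_ : NonZero r}} → r ≥ 2 → n ≥ 1 → r ^ 2 ∣ n →
    SteinerSystem r (r ^ 2) →
    (+ exLin r n (expansion r P₄)) ℚ./ 1 ℚ.≥ (+ ((r + 1) * n)) ℚ./ r
theorem5 (suc zero) n (s≤s ())
-- Matching on `divides q refl` makes `n` equal to `q * r ^ 2`, the number of vertices of `q` copies
-- of the plane.
theorem5 r@(suc s@(suc _)) n _ _ (divides q refl) (m , B , uniform , join) =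
  /-≤ ((r + 1) * n) ex r 1 (begin
    (r + 1) * (q * r ^ 2) * 1  ≡⟨ rearrange r q (r ^ 2) ⟩
    q * (r ^ 2 * suc r)        ≡⟨ cong (q *_) size ⟨
    q * (m * r)                ≡⟨ ℕ.*-assoc q m r ⟨
    q * m * r                  ≤⟨ ℕ.*-monoˡ-≤ r q*m≤ex ⟩
    ex * r                     ∎)
  where
  open AffinePlane s B uniform join
  open Copies q B uniform
  open ℕ.≤-Reasoning

  ex = exLin r n (expansion r P₄)

  rearrange : ∀ r q v → (r + 1) * (q * v) * 1 ≡ q * (v * suc r)
  rearrange = solve-∀

  q*m≤ex : q * m ≤ ex
  q*m≤ex = exLin-upper r n (expansion r P₄) copies
    (copies-uniform , (λ {i} {j} → copies-linear linear {i} {j}) ,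
     noParallelPath⇒P₄-free r copies
       (λ {a} {b} {c} {d} → copies-noParallelPath q B uniform noParallelPath {a} {b} {c} {d}))
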